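{- For every integer $n\geq 1$, the following identities hold in $\mathbb{Z}[x]$: $$x\bigl(F_{2n+1}(x)-F_{2n-1}(x)\bigr) = T_{2n+1}(x)-T_{2n-1}(x)-(3x^2-4)\sum_{k=0}^{n-1}F_{2k+1}(x)T_{2(n-k)-1}(x),$$ $$2xF_{2n+1}(x) = U_{2n+1}(x)-U_{2n-1}(x)-(3x^2-4)\sum_{k=0}^{n-1}F_{2k+1}(x)U_{2(n-k)-1}(x),$$ $$F_{2n}(x)-(2x^2-1)F_{2n-2}(x) = xT_{2n-2}(x)-(3x^2-4)\sum_{k=1}^{n-1}F_{2k}(x)T_{2(n-k-1)}(x),$$ $$F_{2n}(x)+F_{2n-2}(x) = xU_{2n-2}(x)-(3x^2-4)\sum_{k=1}^{n-1}F_{2k}(x)U_{2(n-k-1)}(x).$$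
   Context: The Chebyshev polynomials of the first kind $T_n(x)$ and of the second kind $U_n(x)$ are defined by $T_0(x)=1$, $T_1(x)=x$, $T_{n+1}(x)=2xT_n(x)-T_{n-1}(x)$, and $U_0(x)=1$, $U_1(x)=2x$, $U_{n+1}(x)=2xU_n(x)-U_{n-1}(x)$ for $n\ge 1$. The (Catalan) Fibonacci polynomials $F_n(x)$ are defined by $F_0(x)=0$, $F_1(x)=1$, $F_n(x)=xF_{n-1}(x)+F_{n-2}(x)$ for $n\geq 2$. A sum whose upper limit is smaller than its lower limit is $0$. -}

module Defs where

open import Algebra.Bundles using (RawRing)
open import Data.Integer.Base as ℤ using (ℤ; 0ℤ; 1ℤ; +_)
open import Data.List.Base using (List; []; _∷_; map; foldr; applyUpTo)
open import Data.Nat.Base as ℕ using (ℕ; zero; suc; _∸_)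
open import Level using (0ℓ)
open import Relation.Binary.PropositionalEquality using (_≡_)

infixl 6 _⊕_ _⊖_
infixl 7 _⊗_
infix  8 ⊝_
infix  4 _≈_

-- ℤ[x]: coefficient lists, constant term first. Trailing zeros are allowed,
-- so equality of polynomials is _≈_ and not _≡_.
ℤ[x] : Set
ℤ[x] = List ℤ

coeff : ℤ[x] → ℕ → ℤ
coeff []      _       = 0ℤ
coeff (a ∷ p) zero    = a
coeff (a ∷ p) (suc i) = coeff p i

-- A record, rather than a bare function type, so that p and q can be inferred.
record _≈_ (p q : ℤ[x]) : Set where
  constructor mk≈
  field
    coeff-≡ : ∀ i → coeff p i ≡ coeff q i

open _≈_ public

C : ℤ → ℤ[x]
C a = a ∷ []

X : ℤ[x]
X = 0ℤ ∷ 1ℤ ∷ []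

_⊕_ : ℤ[x] → ℤ[x] → ℤ[x]
[]      ⊕ q       = q
(a ∷ p) ⊕ []      = a ∷ p
(a ∷ p) ⊕ (b ∷ q) = (a ℤ.+ b) ∷ (p ⊕ q)

⊝_ : ℤ[x] → ℤ[x]
⊝ p = map (λ a → ℤ.- a) p

_⊖_ : ℤ[x] → ℤ[x] → ℤ[x]
p ⊖ q = p ⊕ (⊝ q)

-- (a + x p) q = a q + x (p q)
_⊗_ : ℤ[x] → ℤ[x] → ℤ[x]
[]      ⊗ q = []
(a ∷ p) ⊗ q = map (a ℤ.*_) q ⊕ (0ℤ ∷ (p ⊗ q))

ℤ[x]-rawRing : RawRing 0ℓ 0ℓ
ℤ[x]-rawRing = record
  { Carrier = ℤ[x]
  ; _≈_     = _≈_
  ; _+_     = _⊕_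
  ; _*_     = _⊗_
  ; -_      = ⊝_
  ; 0#      = C 0ℤ
  ; 1#      = C 1ℤ
  }

open import Algebra.Definitions.RawSemiring (RawRing.rawSemiring ℤ[x]-rawRing) public
  using (_^_)

-- Both bounds are inclusive; the sum is empty when b < a.
sumFromTo : ℕ → ℕ → (ℕ → ℤ[x]) → ℤ[x]
sumFromTo a b f = foldr _⊕_ (C 0ℤ) (applyUpTo (λ i → f (a ℕ.+ i)) (suc b ∸ a))

syntax sumFromTo a b (λ k → e) = ∑[ k from a to b ] e

T : ℕ → ℤ[x]
T zero          = C 1ℤ
T (suc zero)    = X
T (suc (suc n)) = C (+ 2) ⊗ X ⊗ T (suc n) ⊖ T n

U : ℕ → ℤ[x]
U zero          = C 1ℤ
U (suc zero)    = C (+ 2) ⊗ X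
U (suc (suc n)) = C (+ 2) ⊗ X ⊗ U (suc n) ⊖ U n

F : ℕ → ℤ[x]
F zero          = C 0ℤ
F (suc zero)    = C 1ℤ
F (suc (suc n)) = X ⊗ F (suc n) ⊕ F n

{-# OPTIONS --safe #-}

-- Along indices of one parity, F satisfies aₖ₊₂ = p aₖ₊₁ − aₖ with p = x² + 2, while T and U satisfy
-- bₖ₊₂ = q bₖ₊₁ − bₖ with q = 4x² − 2, and q − p = 3x² − 4. Since q bⱼ = bⱼ₊₁ + bⱼ₋₁ and
-- p aₖ = aₖ₊₁ + aₖ₋₁, the product (q − p) Σ aₖ bₘ₋ₖ telescopes to four boundary terms; each identity
-- is the result for one parity and one of T, U.
module Submission where

open import Algebra.Bundles using (AbelianGroup; CommutativeRing)
import Algebra.Properties.CommutativeSemigroup as CommutativeSemigroupProperties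
import Algebra.Solver.Ring as RingSolver
open import Algebra.Solver.Ring.AlmostCommutativeRing
  using (AlmostCommutativeRing; fromCommutativeRing; _-Raw-AlmostCommutative⟶_)
open import Algebra.Structures using (IsAbelianGroup; IsCommutativeRing)
open import Data.Integer.Base as ℤ using (ℤ; 0ℤ; 1ℤ; +_)
import Data.Integer.Properties as ℤ
open import Data.List.Base using ([]; _∷_; map)
import Data.Maybe.Base as Maybe
open import Data.Nat.Base using (ℕ; zero; suc; _+_; _*_; _∸_; _≥_)
import Data.Nat.Properties as ℕ
open import Data.Product.Base using (_×_; _,_)
open import Function.Base using (_∘_)
open import Level using (0ℓ)
open import Relation.Binary.Definitions using (WeaklyDecidable)
open import Relation.Binary.PropositionalEquality as ≡ using (_≡_; cong; cong₂)
open import Relation.Binary.Structures using (IsEquivalence)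
open import Relation.Nullary.Decidable using (dec⇒maybe)
import Relation.Binary.Reasoning.Setoid as SetoidReasoning
open import Defs

-- ℤ[x] as a commutative ring

≈-isEquivalence : IsEquivalence _≈_
≈-isEquivalence = record
  { refl  = mk≈ λ _ → ≡.refl
  ; sym   = λ p≈q → mk≈ λ i → ≡.sym (coeff-≡ p≈q i)
  ; trans = λ p≈q q≈r → mk≈ λ i → ≡.trans (coeff-≡ p≈q i) (coeff-≡ q≈r i)
  }

open IsEquivalence ≈-isEquivalence renaming (refl to ≈-refl; sym to ≈-sym; trans to ≈-trans)

coeff-⊕ : ∀ p q i → coeff (p ⊕ q) i ≡ coeff p i ℤ.+ coeff q i
coeff-⊕ []      q       i       = ≡.sym (ℤ.+-identityˡ _)
coeff-⊕ (a ∷ p) []      i       = ≡.sym (ℤ.+-identityʳ _)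
coeff-⊕ (a ∷ p) (b ∷ q) zero    = ≡.refl
coeff-⊕ (a ∷ p) (b ∷ q) (suc i) = coeff-⊕ p q i

coeff-map : ∀ (f : ℤ → ℤ) → f 0ℤ ≡ 0ℤ → ∀ p i → coeff (map f p) i ≡ f (coeff p i)
coeff-map f f0 []      i       = ≡.sym f0
coeff-map f f0 (a ∷ p) zero    = ≡.refl
coeff-map f f0 (a ∷ p) (suc i) = coeff-map f f0 p i

coeff-⊝ : ∀ p i → coeff (⊝ p) i ≡ ℤ.- coeff p i
coeff-⊝ = coeff-map ℤ.-_ ≡.refl

coeff-C0 : ∀ i → coeff (C 0ℤ) i ≡ 0ℤ
coeff-C0 zero    = ≡.refl
coeff-C0 (suc i) = ≡.refl

⊕-cong : ∀ {p p′ q q′} → p ≈ p′ → q ≈ q′ → p ⊕ q ≈ p′ ⊕ q′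
⊕-cong {p} {p′} {q} {q′} p≈p′ q≈q′ = mk≈ λ i → ≡.trans (coeff-⊕ p q i)
  (≡.trans (cong₂ ℤ._+_ (coeff-≡ p≈p′ i) (coeff-≡ q≈q′ i)) (≡.sym (coeff-⊕ p′ q′ i)))

⊕-assoc : ∀ p q r → (p ⊕ q) ⊕ r ≈ p ⊕ (q ⊕ r)
⊕-assoc p q r .coeff-≡ i
  rewrite coeff-⊕ (p ⊕ q) r i | coeff-⊕ p q i | coeff-⊕ p (q ⊕ r) i | coeff-⊕ q r i
  = ℤ.+-assoc (coeff p i) (coeff q i) (coeff r i)

⊕-comm : ∀ p q → p ⊕ q ≈ q ⊕ p
⊕-comm p q .coeff-≡ i rewrite coeff-⊕ p q i | coeff-⊕ q p i = ℤ.+-comm (coeff p i) (coeff q i)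

⊕-identityˡ : ∀ p → C 0ℤ ⊕ p ≈ p
⊕-identityˡ p .coeff-≡ i rewrite coeff-⊕ (C 0ℤ) p i | coeff-C0 i = ℤ.+-identityˡ (coeff p i)

⊕-identityʳ : ∀ p → p ⊕ C 0ℤ ≈ p
⊕-identityʳ p = ≈-trans (⊕-comm p (C 0ℤ)) (⊕-identityˡ p)

⊝-inverseˡ : ∀ p → ⊝ p ⊕ p ≈ C 0ℤ
⊝-inverseˡ p .coeff-≡ i rewrite coeff-⊕ (⊝ p) p i | coeff-⊝ p i | coeff-C0 i =
  ℤ.+-inverseˡ (coeff p i)

⊝-inverseʳ : ∀ p → p ⊕ ⊝ p ≈ C 0ℤ
⊝-inverseʳ p = ≈-trans (⊕-comm p (⊝ p)) (⊝-inverseˡ p)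

⊝-cong : ∀ {p q} → p ≈ q → ⊝ p ≈ ⊝ q
⊝-cong {p} {q} p≈q .coeff-≡ i rewrite coeff-⊝ p i | coeff-⊝ q i = cong ℤ.-_ (coeff-≡ p≈q i)

⊕-isAbelianGroup : IsAbelianGroup _≈_ _⊕_ (C 0ℤ) ⊝_
⊕-isAbelianGroup = record
  { isGroup = record
    { isMonoid = record
      { isSemigroup = record
        { isMagma = record { isEquivalence = ≈-isEquivalence ; ∙-cong = ⊕-cong }
        ; assoc   = ⊕-assoc
        }
      ; identity = ⊕-identityˡ , ⊕-identityʳ
      }
    ; inverse = ⊝-inverseˡ , ⊝-inverseʳ
    ; ⁻¹-cong = ⊝-cong
    }
  ; comm = ⊕-comm
  }

⊕-abelianGroup : AbelianGroup 0ℓ 0ℓ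
⊕-abelianGroup = record { isAbelianGroup = ⊕-isAbelianGroup }

open AbelianGroup ⊕-abelianGroup using (commutativeSemigroup; setoid)
open CommutativeSemigroupProperties commutativeSemigroup using (interchange; x∙yz≈y∙xz)
open SetoidReasoning setoid

-- Scaling and multiplication of coefficient lists.

∷-cong : ∀ {a b p q} → a ≡ b → p ≈ q → a ∷ p ≈ b ∷ q
∷-cong a≡b p≈q .coeff-≡ zero    = a≡b
∷-cong a≡b p≈q .coeff-≡ (suc i) = coeff-≡ p≈q i

-- The recursion of `_⊗_` bottoms out in `[]`, while the zero of the ring is `C 0ℤ`; this mediates
-- between the two.
0∷[]≈[] : C 0ℤ ≈ []
0∷[]≈[] .coeff-≡ = coeff-C0

scale : ℤ → ℤ[x] → ℤ[x]
scale a = map (a ℤ.*_)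

coeff-scale : ∀ a p i → coeff (scale a p) i ≡ a ℤ.* coeff p i
coeff-scale a = coeff-map (a ℤ.*_) (ℤ.*-zeroʳ a)

scale-cong : ∀ a {p q} → p ≈ q → scale a p ≈ scale a q
scale-cong a {p} {q} p≈q .coeff-≡ i
  rewrite coeff-scale a p i | coeff-scale a q i = cong (a ℤ.*_) (coeff-≡ p≈q i)

scale-⊕ : ∀ a p q → scale a (p ⊕ q) ≈ scale a p ⊕ scale a q
scale-⊕ a p q .coeff-≡ i
  rewrite coeff-scale a (p ⊕ q) i | coeff-⊕ (scale a p) (scale a q) i | coeff-⊕ p q i
        | coeff-scale a p i | coeff-scale a q i
  = ℤ.*-distribˡ-+ a (coeff p i) (coeff q i)

scale-scale : ∀ a b p → scale (a ℤ.* b) p ≈ scale a (scale b p)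
scale-scale a b p .coeff-≡ i
  rewrite coeff-scale (a ℤ.* b) p i | coeff-scale a (scale b p) i | coeff-scale b p i
  = ℤ.*-assoc a b (coeff p i)

scale-zero : ∀ p → scale 0ℤ p ≈ C 0ℤ
scale-zero p .coeff-≡ i rewrite coeff-scale 0ℤ p i | coeff-C0 i = ≡.refl

scale-one : ∀ p → scale 1ℤ p ≈ p
scale-one p .coeff-≡ i rewrite coeff-scale 1ℤ p i = ℤ.*-identityˡ (coeff p i)

⊗-congˡ : ∀ p {q q′} → q ≈ q′ → p ⊗ q ≈ p ⊗ q′
⊗-congˡ []      q≈q′ = ≈-refl
⊗-congˡ (a ∷ p) q≈q′ = ⊕-cong (scale-cong a q≈q′) (∷-cong ≡.refl (⊗-congˡ p q≈q′))

⊗-zeroʳ : ∀ p → p ⊗ [] ≈ []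
⊗-zeroʳ []      = ≈-refl
⊗-zeroʳ (a ∷ p) = ≈-trans (∷-cong ≡.refl (⊗-zeroʳ p)) 0∷[]≈[]

-- The mirror image of the defining clause of `_⊗_`, p(b + xq) = bp + x(pq). With it, commutativity
-- becomes an induction on the left factor.
⊗-∷ : ∀ p b q → p ⊗ (b ∷ q) ≈ scale b p ⊕ (0ℤ ∷ p ⊗ q)
⊗-∷ []      b q = ≈-sym 0∷[]≈[]
⊗-∷ (a ∷ p) b q = ∷-cong (cong (ℤ._+ 0ℤ) (ℤ.*-comm a b)) (begin
  scale a q ⊕ p ⊗ (b ∷ q)                  ≈⟨ ⊕-cong ≈-refl (⊗-∷ p b q) ⟩
  scale a q ⊕ (scale b p ⊕ (0ℤ ∷ p ⊗ q))   ≈⟨ x∙yz≈y∙xz (scale a q) (scale b p) (0ℤ ∷ p ⊗ q) ⟩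
  scale b p ⊕ (scale a q ⊕ (0ℤ ∷ p ⊗ q))   ∎)

⊗-comm : ∀ p q → p ⊗ q ≈ q ⊗ p
⊗-comm []      q = ≈-sym (⊗-zeroʳ q)
⊗-comm (a ∷ p) q = ≈-trans (⊕-cong ≈-refl (∷-cong ≡.refl (⊗-comm p q))) (≈-sym (⊗-∷ q a p))

-- Equal polynomials may be lists of different lengths, so a direct induction on the left factors
-- does not run in parallel; commutativity moves them to the right.
⊗-cong : ∀ {p p′ q q′} → p ≈ p′ → q ≈ q′ → p ⊗ q ≈ p′ ⊗ q′
⊗-cong {p} {p′} {q} {q′} p≈p′ q≈q′ = begin
  p ⊗ q    ≈⟨ ⊗-congˡ p q≈q′ ⟩
  p ⊗ q′   ≈⟨ ⊗-comm p q′ ⟩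
  q′ ⊗ p   ≈⟨ ⊗-congˡ q′ p≈p′ ⟩
  q′ ⊗ p′  ≈⟨ ⊗-comm q′ p′ ⟩
  p′ ⊗ q′  ∎

⊗-distribˡ-⊕ : ∀ p q r → p ⊗ (q ⊕ r) ≈ p ⊗ q ⊕ p ⊗ r
⊗-distribˡ-⊕ []      q r = ≈-refl
⊗-distribˡ-⊕ (a ∷ p) q r = begin
  scale a (q ⊕ r) ⊕ (0ℤ ∷ p ⊗ (q ⊕ r))
    ≈⟨ ⊕-cong (scale-⊕ a q r) (∷-cong ≡.refl (⊗-distribˡ-⊕ p q r)) ⟩
  (scale a q ⊕ scale a r) ⊕ ((0ℤ ∷ p ⊗ q) ⊕ (0ℤ ∷ p ⊗ r))
    ≈⟨ interchange (scale a q) (scale a r) (0ℤ ∷ p ⊗ q) (0ℤ ∷ p ⊗ r) ⟩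
  (a ∷ p) ⊗ q ⊕ (a ∷ p) ⊗ r
    ∎

⊗-distribʳ-⊕ : ∀ p q r → (q ⊕ r) ⊗ p ≈ q ⊗ p ⊕ r ⊗ p
⊗-distribʳ-⊕ p q r = begin
  (q ⊕ r) ⊗ p    ≈⟨ ⊗-comm (q ⊕ r) p ⟩
  p ⊗ (q ⊕ r)    ≈⟨ ⊗-distribˡ-⊕ p q r ⟩
  p ⊗ q ⊕ p ⊗ r  ≈⟨ ⊕-cong (⊗-comm p q) (⊗-comm p r) ⟩
  q ⊗ p ⊕ r ⊗ p  ∎

0∷-⊗ : ∀ p q → (0ℤ ∷ p) ⊗ q ≈ 0ℤ ∷ p ⊗ q
0∷-⊗ p q = ≈-trans (⊕-cong (scale-zero q) ≈-refl) (⊕-identityˡ (0ℤ ∷ p ⊗ q))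

scale-⊗ : ∀ a p q → scale a p ⊗ q ≈ scale a (p ⊗ q)
scale-⊗ a []      q = ≈-refl
scale-⊗ a (b ∷ p) q = begin
  scale (a ℤ.* b) q ⊕ (0ℤ ∷ scale a p ⊗ q)
    -- The head `0ℤ` is read as `a ℤ.* 0ℤ`, so that the shifted summand is also a multiple by `a`.
    ≈⟨ ⊕-cong (scale-scale a b q) (∷-cong (≡.sym (ℤ.*-zeroʳ a)) (scale-⊗ a p q)) ⟩
  scale a (scale b q) ⊕ scale a (0ℤ ∷ p ⊗ q)
    ≈⟨ scale-⊕ a (scale b q) (0ℤ ∷ p ⊗ q) ⟨
  scale a ((b ∷ p) ⊗ q)
    ∎

⊗-assoc : ∀ p q r → (p ⊗ q) ⊗ r ≈ p ⊗ (q ⊗ r)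
⊗-assoc []      q r = ≈-refl
⊗-assoc (a ∷ p) q r = begin
  (scale a q ⊕ (0ℤ ∷ p ⊗ q)) ⊗ r        ≈⟨ ⊗-distribʳ-⊕ r (scale a q) (0ℤ ∷ p ⊗ q) ⟩
  scale a q ⊗ r ⊕ (0ℤ ∷ p ⊗ q) ⊗ r      ≈⟨ ⊕-cong (scale-⊗ a q r) (0∷-⊗ (p ⊗ q) r) ⟩
  scale a (q ⊗ r) ⊕ (0ℤ ∷ (p ⊗ q) ⊗ r)  ≈⟨ ⊕-cong ≈-refl (∷-cong ≡.refl (⊗-assoc p q r)) ⟩
  (a ∷ p) ⊗ (q ⊗ r)                     ∎

⊗-identityˡ : ∀ p → C 1ℤ ⊗ p ≈ p
⊗-identityˡ p = ≈-trans (⊕-identityʳ (scale 1ℤ p)) (scale-one p)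

⊕-⊗-isCommutativeRing : IsCommutativeRing _≈_ _⊕_ _⊗_ ⊝_ (C 0ℤ) (C 1ℤ)
⊕-⊗-isCommutativeRing = record
  { isRing = record
    { +-isAbelianGroup = ⊕-isAbelianGroup
    ; *-cong           = ⊗-cong
    ; *-assoc          = ⊗-assoc
    ; *-identity       = ⊗-identityˡ , λ p → ≈-trans (⊗-comm p (C 1ℤ)) (⊗-identityˡ p)
    ; distrib          = ⊗-distribˡ-⊕ , ⊗-distribʳ-⊕
    }
  ; *-comm = ⊗-comm
  }

⊕-⊗-commutativeRing : CommutativeRing 0ℓ 0ℓ
⊕-⊗-commutativeRing = record { isCommutativeRing = ⊕-⊗-isCommutativeRing }

⊕-⊗-almostCommutativeRing : AlmostCommutativeRing 0ℓ 0ℓ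
⊕-⊗-almostCommutativeRing = fromCommutativeRing ⊕-⊗-commutativeRing

-- With integers as solver coefficients, literals such as `C (+ 4)` take part in the normalisation.
-- `C a ⊗ C b` computes to `C (a ℤ.* b ℤ.+ 0ℤ)`, hence the correction in `*-homo`.
C-homomorphism : CommutativeRing.rawRing ℤ.+-*-commutativeRing
                   -Raw-AlmostCommutative⟶ ⊕-⊗-almostCommutativeRing
C-homomorphism = record
  { ⟦_⟧    = C
  ; +-homo = λ _ _ → ≈-refl
  ; *-homo = λ a b → ∷-cong (≡.sym (ℤ.+-identityʳ (a ℤ.* b))) ≈-refl
  ; -‿homo = λ _ → ≈-refl
  ; 0-homo = ≈-refl
  ; 1-homo = ≈-refl
  }

C-≟ : WeaklyDecidable (λ a b → C a ≈ C b)
C-≟ a b = Maybe.map (λ a≡b → ∷-cong a≡b ≈-refl) (dec⇒maybe (a ℤ.≟ b))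

open RingSolver (CommutativeRing.rawRing ℤ.+-*-commutativeRing) ⊕-⊗-almostCommutativeRing
  C-homomorphism C-≟ using (solve; _:=_; _:+_; _:*_; _:-_; _:^_; con; Polynomial)

-- Convolutions of two linear recurrences

Recurrence : ℤ[x] → (ℕ → ℤ[x]) → Set
Recurrence p a = ∀ k → a (2 + k) ≈ p ⊗ a (1 + k) ⊖ a k

-- In the last two terms, q ⊗ c 1 ⊖ c 2 and p ⊗ a 0 ⊖ a 1 extend the sequences c ∘ suc and a
-- to the index −1.
convolution : ∀ p q (a c : ℕ → ℤ[x]) → Recurrence p a → Recurrence q (c ∘ suc) → ∀ m →
  (q ⊖ p) ⊗ ∑[ k from 0 to m ] (a k ⊗ c (suc m ∸ k))
    ≈ a 0 ⊗ c (2 + m) ⊖ a (1 + m) ⊗ c 1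
      ⊕ a m ⊗ (q ⊗ c 1 ⊖ c 2) ⊖ (p ⊗ a 0 ⊖ a 1) ⊗ c (1 + m)
convolution p q a c rec-a rec-c zero =
  solve 6 (λ p q a₀ a₁ c₁ c₂ →
      (q :- p) :* (a₀ :* c₁ :+ con 0ℤ)
        := a₀ :* c₂ :- a₁ :* c₁ :+ a₀ :* (q :* c₁ :- c₂) :- (p :* a₀ :- a₁) :* c₁)
    ≈-refl p q (a 0) (a 1) (c 1) (c 2)
convolution p q a c rec-a rec-c (suc m) = begin
  (q ⊖ p) ⊗ (a 0 ⊗ c (2 + m) ⊕ S)
    ≈⟨ ⊗-distribˡ-⊕ (q ⊖ p) (a 0 ⊗ c (2 + m)) S ⟩
  (q ⊖ p) ⊗ (a 0 ⊗ c (2 + m)) ⊕ (q ⊖ p) ⊗ S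
    -- After the summand `k = 0` is split off, what remains is the same convolution for the shifted
    -- sequence `a ∘ suc` and the same `c`.
    ≈⟨ ⊕-cong ≈-refl (convolution p q (a ∘ suc) c (rec-a ∘ suc) rec-c m) ⟩
  (q ⊖ p) ⊗ (a 0 ⊗ c (2 + m)) ⊕ (R ⊖ (p ⊗ a 1 ⊖ a 2) ⊗ c (1 + m))
    -- The shifted sequence, extended one step to the left, must give `a 0` again.
    ≈⟨ ⊕-cong {(q ⊖ p) ⊗ (a 0 ⊗ c (2 + m))} ≈-refl (⊕-cong {R} ≈-refl (⊝-cong
         (⊗-cong {q = c (1 + m)} (⊕-cong {p ⊗ a 1} ≈-refl (⊝-cong (rec-a 0))) ≈-refl))) ⟩
  (q ⊖ p) ⊗ (a 0 ⊗ c (2 + m)) ⊕ (R ⊖ (p ⊗ a 1 ⊖ (p ⊗ a 1 ⊖ a 0)) ⊗ c (1 + m))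
    -- The summand split off supplies q a₀cₘ₊₂ and -p a₀cₘ₊₂. The first joins -a₀cₘ₊₁ to form a₀cₘ₊₃
    -- by `rec-c`; the second is part of the new last boundary term.
    ≈⟨ solve 10 (λ p q a₀ a₁ c₁ c₂ aₘ₊₁ aₘ₊₂ cₘ₊₁ cₘ₊₂ →
         (q :- p) :* (a₀ :* cₘ₊₂)
             :+ (a₁ :* cₘ₊₂ :- aₘ₊₂ :* c₁ :+ aₘ₊₁ :* (q :* c₁ :- c₂)
                  :- (p :* a₁ :- (p :* a₁ :- a₀)) :* cₘ₊₁)
           := a₀ :* (q :* cₘ₊₂ :- cₘ₊₁) :- aₘ₊₂ :* c₁
                :+ aₘ₊₁ :* (q :* c₁ :- c₂) :- (p :* a₀ :- a₁) :* cₘ₊₂)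
         ≈-refl p q (a 0) (a 1) (c 1) (c 2) (a (1 + m)) (a (2 + m)) (c (1 + m)) (c (2 + m)) ⟩
  a 0 ⊗ (q ⊗ c (2 + m) ⊖ c (1 + m)) ⊖ a (2 + m) ⊗ c 1
      ⊕ a (1 + m) ⊗ (q ⊗ c 1 ⊖ c 2) ⊖ (p ⊗ a 0 ⊖ a 1) ⊗ c (2 + m)
    ≈⟨ ⊕-cong (⊕-cong (⊕-cong (⊗-congˡ (a 0) (rec-c m)) ≈-refl) ≈-refl) ≈-refl ⟨
  a 0 ⊗ c (3 + m) ⊖ a (2 + m) ⊗ c 1
      ⊕ a (1 + m) ⊗ (q ⊗ c 1 ⊖ c 2) ⊖ (p ⊗ a 0 ⊖ a 1) ⊗ c (2 + m)
    ∎
  where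
  S = ∑[ k from 0 to m ] (a (suc k) ⊗ c (suc m ∸ k))
  R = a 1 ⊗ c (2 + m) ⊖ a (2 + m) ⊗ c 1 ⊕ a (1 + m) ⊗ (q ⊗ c 1 ⊖ c 2)

-- Subsequences of even and of odd index.

StepTwo : ℤ[x] → (ℕ → ℤ[x]) → Set
StepTwo p g = ∀ k → g (4 + k) ≈ p ⊗ g (2 + k) ⊖ g k

even-recurrence : ∀ p g → StepTwo p g → Recurrence p (λ k → g (2 * k))
even-recurrence p g step k rewrite ℕ.*-suc 2 (suc k) | ℕ.*-suc 2 k = step (2 * k)

odd-recurrence : ∀ p g → StepTwo p g → Recurrence p (λ k → g (2 * k + 1))
odd-recurrence p g step k
  rewrite ℕ.+-comm (2 * (2 + k)) 1 | ℕ.+-comm (2 * (1 + k)) 1 | ℕ.+-comm (2 * k) 1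
  = even-recurrence p (g ∘ suc) (step ∘ suc) k

2*[1+n]∸1≡2*n+1 : ∀ n → 2 * suc n ∸ 1 ≡ 2 * n + 1
2*[1+n]∸1≡2*n+1 n = ≡.trans (cong (_∸ 1) (ℕ.*-suc 2 n)) (ℕ.+-comm 1 (2 * n))

-- The odd subsequence again, with indices in the form that the theorem uses for `T` and `U`.
odd-recurrence′ : ∀ p g → StepTwo p g → Recurrence p (λ k → g (2 * suc k ∸ 1))
odd-recurrence′ p g step k
  rewrite 2*[1+n]∸1≡2*n+1 k | 2*[1+n]∸1≡2*n+1 (1 + k) | 2*[1+n]∸1≡2*n+1 (2 + k)
  = odd-recurrence p g step k

-- The traces of the squared companion matrices of the two recurrences. Those matrices have
-- determinants -1 and 1, so both squares have determinant 1, which is the coefficient of `g k` in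
-- `StepTwo` up to sign.
pF qTU : ℤ[x]
pF  = X ^ 2 ⊕ C (+ 2)
qTU = C (+ 4) ⊗ X ^ 2 ⊖ C (+ 2)

F-step₂ : StepTwo pF F
F-step₂ k = solve 3 (λ x f₀ f₁ →
    x :* (x :* (x :* f₁ :+ f₀) :+ f₁) :+ (x :* f₁ :+ f₀)
      := (x :^ 2 :+ con (+ 2)) :* (x :* f₁ :+ f₀) :- f₀)
  ≈-refl X (F k) (F (1 + k))

-- `T` and `U` differ only in their initial values, so one identity in arbitrary consecutive terms
-- serves both.
chebyshev-step₂ : ∀ x t₀ t₁ → let t₂ = C (+ 2) ⊗ x ⊗ t₁ ⊖ t₀ in
  C (+ 2) ⊗ x ⊗ (C (+ 2) ⊗ x ⊗ t₂ ⊖ t₁) ⊖ t₂ ≈ (C (+ 4) ⊗ x ^ 2 ⊖ C (+ 2)) ⊗ t₂ ⊖ t₀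
chebyshev-step₂ = solve 3 (λ x t₀ t₁ → let t₂ = con (+ 2) :* x :* t₁ :- t₀ in
    con (+ 2) :* x :* (con (+ 2) :* x :* t₂ :- t₁) :- t₂
      := (con (+ 4) :* x :^ 2 :- con (+ 2)) :* t₂ :- t₀)
  ≈-refl

T-step₂ : StepTwo qTU T
T-step₂ k = chebyshev-step₂ X (T k) (T (1 + k))

U-step₂ : StepTwo qTU U
U-step₂ k = chebyshev-step₂ X (U k) (U (1 + k))

-- The convolution sums of the theorem.

odd-convolution : ∀ b → StepTwo qTU b → ∀ m →
  (qTU ⊖ pF) ⊗ ∑[ k from 0 to m ] (F (2 * k + 1) ⊗ b (2 * (suc m ∸ k) ∸ 1))
    ≈ F 1 ⊗ b (2 * suc m + 1) ⊖ F (2 * suc m + 1) ⊗ b 1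
      ⊕ F (2 * suc m ∸ 1) ⊗ (qTU ⊗ b 1 ⊖ b 3) ⊖ (pF ⊗ F 1 ⊖ F 3) ⊗ b (2 * suc m ∸ 1)
odd-convolution b step m = ≡.subst₂
  (λ i j → (qTU ⊖ pF) ⊗ ∑[ k from 0 to m ] (F (2 * k + 1) ⊗ b (2 * (suc m ∸ k) ∸ 1))
    ≈ F 1 ⊗ b i ⊖ F (2 * suc m + 1) ⊗ b 1
      ⊕ F j ⊗ (qTU ⊗ b 1 ⊖ b 3) ⊖ (pF ⊗ F 1 ⊖ F 3) ⊗ b (2 * suc m ∸ 1))
  (2*[1+n]∸1≡2*n+1 (suc m)) (≡.sym (2*[1+n]∸1≡2*n+1 m))
  -- At `j = 0` truncated subtraction gives `b 0`, which breaks the odd pattern; the recurrence for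
  -- `c` is asked for from index 1 on.
  (convolution pF qTU (λ k → F (2 * k + 1)) (λ j → b (2 * j ∸ 1))
    (odd-recurrence pF F F-step₂) (odd-recurrence′ qTU b step) m)

even-convolution : ∀ b → StepTwo qTU b → ∀ m →
  (qTU ⊖ pF) ⊗ ∑[ k from 1 to m ] (F (2 * k) ⊗ b (2 * (suc m ∸ k ∸ 1)))
    ≈ F 0 ⊗ b (2 * suc m) ⊖ F (2 * suc m) ⊗ b 0
      ⊕ F (2 * suc m ∸ 2) ⊗ (qTU ⊗ b 0 ⊖ b 2) ⊖ (pF ⊗ F 0 ⊖ F 2) ⊗ b (2 * suc m ∸ 2)
even-convolution b step m rewrite cong (_∸ 2) (ℕ.*-suc 2 m) = begin
  (qTU ⊖ pF) ⊗ S
    -- As `F 0` is zero, the term `k = 0` can be added to make the sum start at 0.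
    ≈⟨ ⊗-congˡ (qTU ⊖ pF) (solve 2 (λ s t → s := con 0ℤ :* t :+ s) ≈-refl S (b (2 * m))) ⟩
  (qTU ⊖ pF) ⊗ (F 0 ⊗ b (2 * m) ⊕ S)
    -- The shift `j ∸ 1` makes `c 1` equal to `b 0`, since `c` enters the convolution from index 1
    -- on.
    ≈⟨ convolution pF qTU (λ k → F (2 * k)) (λ j → b (2 * (j ∸ 1)))
         (even-recurrence pF F F-step₂) (even-recurrence qTU b step) m ⟩
  F 0 ⊗ b (2 * suc m) ⊖ F (2 * suc m) ⊗ b 0
      ⊕ F (2 * m) ⊗ (qTU ⊗ b 0 ⊖ b 2) ⊖ (pF ⊗ F 0 ⊖ F 2) ⊗ b (2 * m)
    ∎
  where S = ∑[ k from 1 to m ] (F (2 * k) ⊗ b (2 * (suc m ∸ k ∸ 1)))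

-- Here `t` is the boundary value of the convolution `s`. Since `qTU ⊖ pF` is 3x² - 4, each identity
-- reduces to the sum-free claim `l ⊕ t ≈ r`.
isolate : ∀ {l r s t} → (qTU ⊖ pF) ⊗ s ≈ t → l ⊕ t ≈ r →
          l ≈ r ⊖ (C (+ 3) ⊗ X ^ 2 ⊖ C (+ 4)) ⊗ s
isolate {l} {r} {s} {t} ds≈t l+t≈r = begin
  l
    ≈⟨ solve 2 (λ l t → l := l :+ t :- t) ≈-refl l t ⟩
  l ⊕ t ⊖ t
    ≈⟨ ⊕-cong l+t≈r (⊝-cong (≈-sym ds≈t)) ⟩
  r ⊖ (qTU ⊖ pF) ⊗ s
    ≈⟨ solve 3 (λ x r s →
         r :- ((con (+ 4) :* x :^ 2 :- con (+ 2)) :- (x :^ 2 :+ con (+ 2))) :* s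
           := r :- (con (+ 3) :* x :^ 2 :- con (+ 4)) :* s)
         ≈-refl X r s ⟩
  r ⊖ (C (+ 3) ⊗ X ^ 2 ⊖ C (+ 4)) ⊗ s
    ∎

theorem2 : (n : ℕ) → n ≥ 1 →
    (X ⊗ (F (2 * n + 1) ⊖ F (2 * n ∸ 1))
    ≈ T (2 * n + 1) ⊖ T (2 * n ∸ 1)
    ⊖ (C (+ 3) ⊗ X ^ 2 ⊖ C (+ 4)) ⊗ ∑[ k from 0 to n ∸ 1 ] (F (2 * k + 1) ⊗ T (2 * (n ∸ k) ∸ 1)))
    × (C (+ 2) ⊗ X ⊗ F (2 * n + 1)
    ≈ U (2 * n + 1) ⊖ U (2 * n ∸ 1)
    ⊖ (C (+ 3) ⊗ X ^ 2 ⊖ C (+ 4)) ⊗ ∑[ k from 0 to n ∸ 1 ] (F (2 * k + 1) ⊗ U (2 * (n ∸ k) ∸ 1)))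
    × (F (2 * n) ⊖ (C (+ 2) ⊗ X ^ 2 ⊖ C (+ 1)) ⊗ F (2 * n ∸ 2)
    ≈ X ⊗ T (2 * n ∸ 2)
    ⊖ (C (+ 3) ⊗ X ^ 2 ⊖ C (+ 4)) ⊗ ∑[ k from 1 to n ∸ 1 ] (F (2 * k) ⊗ T (2 * (n ∸ k ∸ 1))))
    × (F (2 * n) ⊕ F (2 * n ∸ 2)
    ≈ X ⊗ U (2 * n ∸ 2)
    ⊖ (C (+ 3) ⊗ X ^ 2 ⊖ C (+ 4)) ⊗ ∑[ k from 1 to n ∸ 1 ] (F (2 * k) ⊗ U (2 * (n ∸ k ∸ 1))))
theorem2 zero    ()
theorem2 (suc m) _ =
    -- Extended to the left, T₋₁ = x and F₋₁ = 1, so the boundary value is T₂ₙ₊₁ - xF₂ₙ₊₁ + xF₂ₙ₋₁ -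
    -- T₂ₙ₋₁.
    isolate (odd-convolution T T-step₂ m)
      (solve 5 (λ x f f′ t t′ →
          x :* (f′ :- f) :+ (con 1ℤ :* t′ :- f′ :* x
              :+ f :* (q x :* x :- (con (+ 2) :* x :* (con (+ 2) :* x :* x :- con 1ℤ) :- x))
              :- (p x :* con 1ℤ :- F₃ x) :* t)
            := t′ :- t)
        ≈-refl X (F (2 * suc m ∸ 1)) (F (2 * suc m + 1)) (T (2 * suc m ∸ 1)) (T (2 * suc m + 1)))
  -- Here U₋₁ = 0, so F₂ₙ₋₁ drops out.
  , isolate (odd-convolution U U-step₂ m)
      (solve 5 (λ x f f′ u u′ → let 2x = con (+ 2) :* x in
          2x :* f′ :+ (con 1ℤ :* u′ :- f′ :* 2x
              :+ f :* (q x :* 2x :- (2x :* (2x :* 2x :- con 1ℤ) :- 2x))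
              :- (p x :* con 1ℤ :- F₃ x) :* u)
            := u′ :- u)
        ≈-refl X (F (2 * suc m ∸ 1)) (F (2 * suc m + 1)) (U (2 * suc m ∸ 1)) (U (2 * suc m + 1)))
  -- Now T₋₂ = 2x² - 1 is the factor of F₂ₙ₋₂, and F₋₂ = -x yields the term xT₂ₙ₋₂.
  , isolate (even-convolution T T-step₂ m)
      (solve 5 (λ x f f′ t t′ →
          f′ :- (con (+ 2) :* x :^ 2 :- con 1ℤ) :* f :+ (con 0ℤ :* t′ :- f′ :* con 1ℤ
              :+ f :* (q x :* con 1ℤ :- (con (+ 2) :* x :* x :- con 1ℤ))
              :- (p x :* con 0ℤ :- F₂ x) :* t)
            := x :* t)
        ≈-refl X (F (2 * suc m ∸ 2)) (F (2 * suc m)) (T (2 * suc m ∸ 2)) (T (2 * suc m)))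
  -- Here U₋₂ = -1, hence the plus sign before F₂ₙ₋₂.
  , isolate (even-convolution U U-step₂ m)
      (solve 5 (λ x f f′ u u′ → let 2x = con (+ 2) :* x in
          f′ :+ f :+ (con 0ℤ :* u′ :- f′ :* con 1ℤ
              :+ f :* (q x :* con 1ℤ :- (2x :* 2x :- con 1ℤ))
              :- (p x :* con 0ℤ :- F₂ x) :* u)
            := x :* u)
        ≈-refl X (F (2 * suc m ∸ 2)) (F (2 * suc m)) (U (2 * suc m ∸ 2)) (U (2 * suc m)))
  where
  -- Solver terms for `pF`, `qTU`, `F 2` and `F 3`, written just as these unfold so that the solved
  -- equation matches the goal by computation.
  p q F₂ F₃ : Polynomial 5 → Polynomial 5
  p x  = x :^ 2 :+ con (+ 2)
  q x  = con (+ 4) :* x :^ 2 :- con (+ 2)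
  F₂ x = x :* con 1ℤ :+ con 0ℤ
  F₃ x = x :* F₂ x :+ con 1ℤ
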